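{- Let $m\ge 1$ and $n\ge 1$ be integers and let $G=K_m\circ\overline{K_n}$ (equivalently, the complete $m$-partite graph $K_{n,n,\ldots,n}$ with $m$ parts of size $n$), a graph on $mn$ vertices. If $n\ge 2$, then $G$ is orientable $\mathbb{Z}_{mn}$-distance magic if and only if $n\not\equiv 1\pmod 2$ or $m\not\equiv 2\pmod 4$. If $n=1$ (so $G=K_m$), then $G$ is orientable $\mathbb{Z}_{m}$-distance magic if and only if $m$ is odd.
   Context: For graphs $G,H$, the lexicographic product $G\circ H$ has vertex set $V(G)\times V(H)$, with $(g,h)$ adjacent to $(g',h')$ iff $g$ is adjacent to $g'$ in $G$, or $g=g'$ and $h$ is adjacent to $h'$ in $H$. $\overline{K_n}$ denotes the edgeless graph on $n$ vertices. For an oriented graph $\vec G$ and a vertex $x$, $N^+(x)$ is the set of vertices $y$ with an arc from $x$ to $y$, and $N^-(x)$ is the set of vertices $y$ with an arc from $y$ to $x$. For an Abelian group $\Gamma$ of order $n$, a directed $\Gamma$-distance magic labeling of an oriented graph $\vec G$ of order $n$ is a bijection $\vec l:V\to\Gamma$ such that there is $\mu\in\Gamma$ with $\sum_{y\in N^+(x)}\vec l(y)-\sum_{y\in N^-(x)}\vec l(y)=\mu$ for every vertex $x$. A simple graph $G$ of order $n$ is orientable $\Gamma$-distance magic if some orientation of its edges admits a directed $\Gamma$-distance magic labeling. $\mathbb{Z}_n$ is the cyclic group of integers modulo $n$. -}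

module Defs where

open import Algebra.Bundles using (AbelianGroup)
import Algebra.Properties.CommutativeMonoid.Sum as CommutativeMonoidSum
open import Data.Bool.Base using (if_then_else_)
open import Data.Empty using (⊥)
open import Data.Fin.Base using (Fin)
import Data.Fin.Properties as Fin
open import Data.Integer.Base as ℤ using (ℤ; +_)
open import Data.Integer.Divisibility.Signed using (_∣_; divides; ∣m∣n⇒∣m+n; ∣m⇒∣-m)
import Data.Integer.Properties as ℤ
open import Data.Integer.Tactic.RingSolver using (solve-∀)
open import Data.Nat.Base using (ℕ)
import Data.Nat.Base as ℕ
open import Data.Product.Base using (_×_; _,_; Σ-syntax; ∃-syntax)
open import Data.Product.Function.NonDependent.Propositional using (_×-↔_)
open import Data.Sum.Base using (_⊎_; inj₁; inj₂)
open import Function.Base using (id)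
open import Function.Bundles using (_↔_; Inverse; Bijection)
open import Function.Construct.Composition using (_↔-∘_)
open import Function.Construct.Identity using (↔-id)
open import Function.Construct.Symmetry using (↔-sym)
open import Function.Properties.Inverse using (↔⇒↣)
open import Level using (0ℓ; suc; _⊔_)
open import Relation.Binary.Core using (Rel)
open import Relation.Binary.Definitions
  using (Asymmetric; Decidable; DecidableEquality; Irreflexive; Symmetric)
open import Relation.Binary.PropositionalEquality.Core using (_≡_; _≢_; refl; sym; subst)
open import Relation.Binary.PropositionalEquality.Properties using (setoid)
open import Relation.Nullary.Decidable
  using (does; no; ¬?; _×-dec_; _⊎-dec_; via-injection)
import Relation.Unary as U
open import Relation.Unary using (Pred)

record SimpleGraph : Set₁ where
  field
    Vertex : Set
    order  : ℕ
    enum   : Fin order ↔ Vertex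
    Adj    : Rel Vertex 0ℓ
    adj?   : Decidable Adj
    symm   : Symmetric Adj
    irrefl : Irreflexive _≡_ Adj

  vertexAt : Fin order → Vertex
  vertexAt = Inverse.to enum

  infix 4 _≟_
  _≟_ : DecidableEquality Vertex
  _≟_ = via-injection (↔⇒↣ (↔-sym enum)) Fin._≟_

K : ℕ → SimpleGraph
K m = record
  { Vertex = Fin m
  ; order  = m
  ; enum   = ↔-id (Fin m)
  ; Adj    = _≢_
  ; adj?   = λ x y → ¬? (x Fin.≟ y)
  ; symm   = λ x≢y y≡x → x≢y (sym y≡x)
  ; irrefl = λ x≡y x≢y → x≢y x≡y
  }

-- The complement of K n.
K̅ : ℕ → SimpleGraph
K̅ n = record
  { Vertex = Fin n
  ; order  = n
  ; enum   = ↔-id (Fin n)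
  ; Adj    = λ _ _ → ⊥
  ; adj?   = λ _ _ → no id
  ; symm   = id
  ; irrefl = λ _ → id
  }

infixr 7 _∘ₗ_
_∘ₗ_ : SimpleGraph → SimpleGraph → SimpleGraph
G ∘ₗ H = record
  { Vertex = G.Vertex × H.Vertex
  ; order  = G.order ℕ.* H.order
  ; enum   = (G.enum ×-↔ H.enum) ↔-∘ Fin.*↔×
  ; Adj    = λ (g , h) (g′ , h′) → G.Adj g g′ ⊎ (g ≡ g′ × H.Adj h h′)
  ; adj?   = λ (g , h) (g′ , h′) → G.adj? g g′ ⊎-dec ((g G.≟ g′) ×-dec H.adj? h h′)
  ; symm   = λ { (inj₁ a) → inj₁ (G.symm a)
               ; (inj₂ (e , a)) → inj₂ (sym e , H.symm a) }
  ; irrefl = λ { refl (inj₁ a) → G.irrefl refl a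
               ; refl (inj₂ (_ , a)) → H.irrefl refl a }
  }
  where
  module G = SimpleGraph G
  module H = SimpleGraph H

record Orientation (G : SimpleGraph) : Set₁ where
  open SimpleGraph G using (Adj) renaming (Vertex to V)
  field
    Arc     : Rel V 0ℓ
    arc?    : Decidable Arc
    arc⇒adj : ∀ {x y} → Arc x y → Adj x y
    adj⇒arc : ∀ {x y} → Adj x y → Arc x y ⊎ Arc y x
    asym    : Asymmetric Arc

  N⁺ : V → Pred V 0ℓ
  N⁺ x y = Arc x y

  N⁺? : ∀ x → U.Decidable (N⁺ x)
  N⁺? x y = arc? x y

  N⁻ : V → Pred V 0ℓ
  N⁻ x y = Arc y x

  N⁻? : ∀ x → U.Decidable (N⁻ x)
  N⁻? x y = arc? y x

module _ {c ℓ} (Γ : AbelianGroup c ℓ) (G : SimpleGraph) where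
  open AbelianGroup Γ using (Carrier; _≈_; _∙_; ε; _⁻¹; commutativeMonoid)
    renaming (setoid to Γ-setoid)
  open CommutativeMonoidSum commutativeMonoid using (sum)
  open SimpleGraph G using (vertexAt) renaming (Vertex to V)

  sumOver : {P : Pred V 0ℓ} → U.Decidable P → (V → Carrier) → Carrier
  sumOver P? f = sum λ i → if does (P? (vertexAt i)) then f (vertexAt i) else ε

  -- The bijection forces the order of Γ to be that of G.
  record DirectedDistanceMagicLabeling (G⃗ : Orientation G) : Set (c ⊔ ℓ) where
    open Orientation G⃗
    field
      labeling : Bijection (setoid V) Γ-setoid
    l : V → Carrier
    l = Bijection.to labeling
    field
      magic : ∃[ μ ] (∀ x → sumOver (N⁺? x) l ∙ sumOver (N⁻? x) l ⁻¹ ≈ μ)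

  OrientableDistanceMagic : Set (suc 0ℓ ⊔ c ⊔ ℓ)
  OrientableDistanceMagic = Σ[ G⃗ ∈ Orientation G ] DirectedDistanceMagicLabeling G⃗

-- The cyclic group ℤ/N, as the integers with congruence modulo N for equality.
module _ (N : ℕ) where
  private
    infix 4 _≈_
    _≈_ : Rel ℤ 0ℓ
    a ≈ b = + N ∣ a ℤ.- b

    reflexive : ∀ {a b} → a ≡ b → a ≈ b
    reflexive {a} refl = divides (+ 0) (ℤ.+-inverseʳ a)

    ≈-sym : ∀ {a b} → a ≈ b → b ≈ a
    ≈-sym {a} {b} p = subst (+ N ∣_) (eq a b) (∣m⇒∣-m p)
      where
      eq : ∀ a b → ℤ.- (a ℤ.- b) ≡ b ℤ.- a
      eq = solve-∀

    ≈-trans : ∀ {a b c} → a ≈ b → b ≈ c → a ≈ c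
    ≈-trans {a} {b} {c} p q = subst (+ N ∣_) (eq a b c) (∣m∣n⇒∣m+n p q)
      where
      eq : ∀ a b c → (a ℤ.- b) ℤ.+ (b ℤ.- c) ≡ a ℤ.- c
      eq = solve-∀

    +-cong : ∀ {a b c d} → a ≈ b → c ≈ d → a ℤ.+ c ≈ b ℤ.+ d
    +-cong {a} {b} {c} {d} p q = subst (+ N ∣_) (eq a b c d) (∣m∣n⇒∣m+n p q)
      where
      eq : ∀ a b c d → (a ℤ.- b) ℤ.+ (c ℤ.- d) ≡ (a ℤ.+ c) ℤ.- (b ℤ.+ d)
      eq = solve-∀

    neg-cong : ∀ {a b} → a ≈ b → ℤ.- a ≈ ℤ.- b
    neg-cong {a} {b} p = subst (+ N ∣_) (eq a b) (∣m⇒∣-m p)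
      where
      eq : ∀ a b → ℤ.- (a ℤ.- b) ≡ (ℤ.- a) ℤ.- (ℤ.- b)
      eq = solve-∀

  ℤMod : AbelianGroup 0ℓ 0ℓ
  ℤMod = record
    { Carrier = ℤ
    ; _≈_ = _≈_
    ; _∙_ = ℤ._+_
    ; ε = + 0
    ; _⁻¹ = ℤ.-_
    ; isAbelianGroup = record
      { isGroup = record
        { isMonoid = record
          { isSemigroup = record
            { isMagma = record
              { isEquivalence = record
                { refl = λ {a} → reflexive {a} refl
                ; sym = λ {a b} → ≈-sym {a} {b}
                ; trans = λ {a b c} → ≈-trans {a} {b} {c}
                }
              ; ∙-cong = λ {a b c d} → +-cong {a} {b} {c} {d}
              }
            ; assoc = λ a b c → reflexive (ℤ.+-assoc a b c)
            }
          ; identity = (λ a → reflexive (ℤ.+-identityˡ a)) , (λ a → reflexive (ℤ.+-identityʳ a))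
          }
        ; inverse = (λ a → reflexive (ℤ.+-inverseˡ a)) , (λ a → reflexive (ℤ.+-inverseʳ a))
        ; ⁻¹-cong = λ {a b} → neg-cong {a} {b}
        }
      ; comm = λ a b → reflexive (ℤ.+-comm a b)
      }
    }

{-# OPTIONS --safe #-}
-- Non-existence: modulo 2 signs are invisible, so the weight of a vertex is the sum T of all
-- labels minus the label sum of its own part, and all part sums have the same parity.  For
-- m ≡ 2 (mod 4) and n odd this makes T even, whereas T ≡ mn(mn - 1)/2 is odd; for n = 1 and
-- m even it makes all labels have the same parity.
--
-- Existence, n even or m odd: let the parts be the cosets of ⟨m⟩ and orient by the
-- difference of labels.  A weight is ∑ ε(d)(d + x) = ∑ ε(d) d + x ∑ ε(d), and ∑ ε(d) = 0
-- because ε is odd.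
--
-- Existence, 4 ∣ m and n ≥ 3 odd: give the vertices signs σ such that the signed label sum of
-- every part is 0, and orient the arc between x and y by ± σ(x) σ(y), where ± depends only on
-- the two parts.  All weights are then 0.
module Submission where

open import Defs
open import Algebra.Bundles using (AbelianGroup; CommutativeMonoid)
import Algebra.Properties.CommutativeMonoid.Sum as CommutativeMonoidSum
import Algebra.Properties.Semiring.Sum as SemiringSum
open import Data.Bool.Base using (if_then_else_; true; false)
open import Data.Fin.Base as Fin
  using (Fin; zero; suc; toℕ; fromℕ<; combine; remQuot; opposite; _↑ˡ_; _↑ʳ_)
open import Data.Fin.Patterns using (0F; 1F; 2F)
open import Data.Fin.Permutation using (permutation)
import Data.Fin.Properties as Fin
open import Data.Integer.Base as ℤ using (ℤ; +_; -[1+_]; +[1+_]; 0ℤ; 1ℤ; -1ℤ; ∣_∣; _%ℕ_; _/ℕ_)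
open import Data.Integer.Divisibility.Signed
  using (_∣_; _∣?_; divides; ∣⇒∣ᵤ; ∣ᵤ⇒∣; ∣-trans; ∣m∣n⇒∣m+n; ∣m∣n⇒∣m-n; ∣m⇒∣-m; ∣m⇒∣m*n; ∣n⇒∣m*n;
         ∣m+n∣n⇒∣m; ∣m+n∣m⇒∣n)
open import Data.Integer.DivMod using (a≡a%ℕn+[a/ℕn]*n; n%ℕd<d)
import Data.Integer.Properties as ℤ
import Data.Integer.Tactic.RingSolver as ℤ-Solver
open import Data.Nat.Base as ℕ using (ℕ; _≤_; _<_; _+_; _∸_; _*_; _%_; _/_; NonZero; s≤s; z≤n)
import Data.Nat.Divisibility as ℕ
open import Data.Nat.DivMod using (m≡m%n+[m/n]*n; m%n<n)
import Data.Nat.Properties as ℕ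
import Data.Nat.Tactic.RingSolver as ℕ-Solver
open import Data.Product.Base using (_×_; _,_; proj₁; proj₂; ∃-syntax)
open import Data.Sum.Base using (_⊎_; inj₁; inj₂)
open import Function.Base using (_∘_)
open import Function.Bundles using (_⇔_; mk⇔; Inverse; Bijection)
open import Relation.Binary.PropositionalEquality
open import Relation.Nullary.Decidable using (yes; no; does; does-⇔; dec-true; dec-false)
open import Relation.Nullary.Negation using (¬_; contradiction)

open SemiringSum ℤ.+-*-semiring
  using (sum; sum-cong-≗; ∑-distrib-+; *-distribˡ-sum; *-distribʳ-sum; sum-replicate-zero)

-- Integer signs and finite sums.

sgn : ℤ → ℤ
sgn (+ ℕ.zero) = 0ℤ
sgn +[1+ _ ]   = 1ℤ
sgn -[1+ _ ]   = -1ℤ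

sgn-neg : ∀ z → sgn (ℤ.- z) ≡ ℤ.- sgn z
sgn-neg (+ ℕ.zero) = refl
sgn-neg +[1+ _ ]   = refl
sgn-neg -[1+ _ ]   = refl

sgn-±1 : ∀ {z} → z ≢ 0ℤ → sgn z ≡ 1ℤ ⊎ sgn z ≡ -1ℤ
sgn-±1 {+ ℕ.zero} z≢0 = contradiction refl z≢0
sgn-±1 {+[1+ _ ]} _   = inj₁ refl
sgn-±1 { -[1+ _ ]} _  = inj₂ refl

≡-neg⇒≡0 : ∀ {z} → z ≡ ℤ.- z → z ≡ 0ℤ
≡-neg⇒≡0 {+ ℕ.zero} _ = refl

sum-ones : ∀ n → sum (λ (_ : Fin n) → 1ℤ) ≡ + n
sum-ones ℕ.zero    = refl
sum-ones (ℕ.suc n) = cong (λ z → 1ℤ ℤ.+ z) (sum-ones n)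

sum-++ : ∀ m {n} (f : Fin (m + n) → ℤ) → sum f ≡ sum (f ∘ (_↑ˡ n)) ℤ.+ sum (f ∘ (m ↑ʳ_))
sum-++ ℕ.zero    f = sym (ℤ.+-identityˡ (sum f))
sum-++ (ℕ.suc m) f = trans (cong (λ z → f zero ℤ.+ z) (sum-++ m (f ∘ suc))) (sym (ℤ.+-assoc (f zero) _ _))

sum-combine : ∀ m {n} (f : Fin (m * n) → ℤ) → sum f ≡ sum (λ i → sum (λ j → f (combine {m} i j)))
sum-combine ℕ.zero        f = refl
sum-combine (ℕ.suc m) {n} f =
  trans (sum-++ n f) (cong (λ z → sum (λ j → f (j ↑ˡ (m * n))) ℤ.+ z) (sum-combine m (λ i → f (n ↑ʳ i))))

sum-vertices : ∀ m n (f : Fin m × Fin n → ℤ) →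
               sum (λ i → f (SimpleGraph.vertexAt (K m ∘ₗ K̅ n) i)) ≡ sum (λ i → sum (λ j → f (i , j)))
sum-vertices m n f = trans (sum-combine m (λ i → f (remQuot {m} n i)))
  (sum-cong-≗ λ i → sum-cong-≗ λ j → cong f (Fin.remQuot-combine {m} {n} i j))

-- Subtraction under the sum is written as multiplication by `-1ℤ`, so that distributivity takes the
-- sign out of the sum.
sum-minus : ∀ {n} (f g : Fin n → ℤ) → sum (λ i → f i ℤ.+ -1ℤ ℤ.* g i) ≡ sum f ℤ.- sum g
sum-minus f g = begin
  sum (λ i → f i ℤ.+ -1ℤ ℤ.* g i)       ≡⟨ ∑-distrib-+ f (λ i → -1ℤ ℤ.* g i) ⟩
  sum f ℤ.+ sum (λ i → -1ℤ ℤ.* g i)     ≡⟨ cong (λ z → sum f ℤ.+ z) (*-distribˡ-sum -1ℤ g) ⟨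
  sum f ℤ.+ -1ℤ ℤ.* sum g               ≡⟨ cong (λ z → sum f ℤ.+ z) (ℤ.-1*i≡-i (sum g)) ⟩
  sum f ℤ.- sum g                       ∎
  where open ≡-Reasoning

∣-sum : ∀ {d n} {f : Fin n → ℤ} → (∀ i → d ∣ f i) → d ∣ sum f
∣-sum {n = ℕ.zero}  d∣f = divides 0ℤ refl
∣-sum {n = ℕ.suc _} d∣f = ∣m∣n⇒∣m+n (d∣f zero) (∣-sum (d∣f ∘ suc))

-- Gauss's formula, doubled to avoid division and stated over ℤ so that `n - 1` is not truncated at
-- 0.
sum-toℕ : ∀ n → + 2 ℤ.* sum (λ (i : Fin n) → + toℕ i) ≡ + n ℤ.* (+ n ℤ.- 1ℤ)
sum-toℕ ℕ.zero    = refl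
sum-toℕ (ℕ.suc n) = begin
  + 2 ℤ.* (0ℤ ℤ.+ sum (λ (i : Fin n) → 1ℤ ℤ.+ + toℕ i))
    ≡⟨ cong (λ s → + 2 ℤ.* (0ℤ ℤ.+ s)) (∑-distrib-+ (λ (_ : Fin n) → 1ℤ) (λ i → + toℕ i)) ⟩
  + 2 ℤ.* (0ℤ ℤ.+ (sum (λ (_ : Fin n) → 1ℤ) ℤ.+ S))
    ≡⟨ cong (λ c → + 2 ℤ.* (0ℤ ℤ.+ (c ℤ.+ S))) (sum-ones n) ⟩
  + 2 ℤ.* (0ℤ ℤ.+ (+ n ℤ.+ S))                           ≡⟨ split (+ n) S ⟩
  + 2 ℤ.* + n ℤ.+ + 2 ℤ.* S                              ≡⟨ cong (λ s → + 2 ℤ.* + n ℤ.+ s) (sum-toℕ n) ⟩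
  + 2 ℤ.* + n ℤ.+ + n ℤ.* (+ n ℤ.- 1ℤ)                   ≡⟨ collect (+ n) ⟩
  (1ℤ ℤ.+ + n) ℤ.* (1ℤ ℤ.+ + n ℤ.- 1ℤ)                   ∎
  where
  open ≡-Reasoning
  S = sum (λ (i : Fin n) → + toℕ i)
  split : ∀ n s → + 2 ℤ.* (0ℤ ℤ.+ (n ℤ.+ s)) ≡ + 2 ℤ.* n ℤ.+ + 2 ℤ.* s
  split = ℤ-Solver.solve-∀
  collect : ∀ n → + 2 ℤ.* n ℤ.+ n ℤ.* (n ℤ.- 1ℤ) ≡ (1ℤ ℤ.+ n) ℤ.* (1ℤ ℤ.+ n ℤ.- 1ℤ)
  collect = ℤ-Solver.solve-∀

-- The Kronecker delta; it turns the label sum of one part into a sum over all vertices.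
δ : ∀ {m} → Fin m → Fin m → ℤ
δ i i′ = if does (i Fin.≟ i′) then 1ℤ else 0ℤ

sum-δ : ∀ {m} (i : Fin m) (f : Fin m → ℤ) → sum (λ i′ → δ i i′ ℤ.* f i′) ≡ f i
sum-δ {ℕ.suc m} zero f =
  trans (cong₂ ℤ._+_ (ℤ.*-identityˡ (f zero)) (sum-replicate-zero m)) (ℤ.+-identityʳ (f zero))
-- `does (suc i ≟ suc i′)` reduces to `does (i ≟ i′)`, so the tail is literally the sum for `i`.
sum-δ (suc i) f = trans (ℤ.+-identityˡ _) (sum-δ i (f ∘ suc))

-- Congruences and residues.

infix 4 _≡_mod_
-- Definitionally the equality of `ℤMod N`. Being divisibility of a difference, it does not
-- determine its two sides for unification, hence the many implicit arguments supplied by hand.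
_≡_mod_ : ℤ → ℤ → ℕ → Set
a ≡ b mod N = + N ∣ a ℤ.- b

module Mod N = AbelianGroup (ℤMod N)

mod-reflexive : ∀ {N a b} → a ≡ b → a ≡ b mod N
mod-reflexive {N} = Mod.reflexive N

mod-sym : ∀ {N a b} → a ≡ b mod N → b ≡ a mod N
mod-sym {N} {a} {b} = Mod.sym N {a} {b}

mod-trans : ∀ {N a b c} → a ≡ b mod N → b ≡ c mod N → a ≡ c mod N
mod-trans {N} {a} {b} {c} = Mod.trans N {a} {b} {c}

-- The difference is a multiple of `N` of absolute value below `N`, hence 0.
residue-unique : ∀ {N r s} → r < N → s < N → + r ≡ + s mod N → r ≡ s
residue-unique {N} {r} {s} r<N s<N r≡s = ℤ.+-injective (ℤ.i-j≡0⇒i≡j (+ r) (+ s) (ℤ.∣i∣≡0⇒i≡0 ∣r-s∣≡0))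
  where
  ∣r-s∣<N : ∣ + r ℤ.- + s ∣ < N
  ∣r-s∣<N = ℕ.≤-<-trans
    (subst (λ z → ∣ z ∣ ≤ r ℕ.⊔ s) (sym (ℤ.m-n≡m⊖n r s)) (ℤ.∣m⊝n∣≤m⊔n r s))
    (ℕ.⊔-lub r<N s<N)

  ∣r-s∣≡0 : ∣ + r ℤ.- + s ∣ ≡ 0
  ∣r-s∣≡0 with ∣ + r ℤ.- + s ∣ | ∣r-s∣<N | ∣⇒∣ᵤ r≡s
  ... | ℕ.zero  | _   | _   = refl
  ... | ℕ.suc _ | d<N | N∣d = contradiction N∣d (ℕ.>⇒∤ d<N)

module _ (N : ℕ) .{{_ : NonZero N}} where

  ≡%ℕ-mod : ∀ z → z ≡ + (z %ℕ N) mod N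
  ≡%ℕ-mod z = divides (z /ℕ N) (begin
    z ℤ.- + (z %ℕ N)                                      ≡⟨ cong (ℤ._- + (z %ℕ N)) (a≡a%ℕn+[a/ℕn]*n z N) ⟩
    + (z %ℕ N) ℤ.+ (z /ℕ N) ℤ.* + N ℤ.- + (z %ℕ N)  ≡⟨ cancel (+ (z %ℕ N)) _ ⟩
    (z /ℕ N) ℤ.* + N                                      ∎)
    where
    open ≡-Reasoning
    cancel : ∀ a b → a ℤ.+ b ℤ.- a ≡ b
    cancel = ℤ-Solver.solve-∀

  %ℕ-unique : ∀ {z r} → r < N → z ≡ + r mod N → z %ℕ N ≡ r
  %ℕ-unique {z} {r} r<N z≡r = residue-unique (n%ℕd<d z N) r<N
    (mod-trans {N} {+ (z %ℕ N)} {z} (mod-sym {N} {z} (≡%ℕ-mod z)) z≡r)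

  %ℕ-cong : ∀ {a b} → a ≡ b mod N → a %ℕ N ≡ b %ℕ N
  %ℕ-cong {a} {b} a≡b = %ℕ-unique {a} (n%ℕd<d b N) (mod-trans {N} {a} {b} a≡b (≡%ℕ-mod b))

  residue : ℤ → Fin N
  residue z = fromℕ< (n%ℕd<d z N)

  toℕ-residue : ∀ z → toℕ (residue z) ≡ z %ℕ N
  toℕ-residue z = Fin.toℕ-fromℕ< (n%ℕd<d z N)

  ≡residue-mod : ∀ z → z ≡ + toℕ (residue z) mod N
  ≡residue-mod z = subst (λ r → z ≡ + r mod N) (sym (toℕ-residue z)) (≡%ℕ-mod z)

  residue-cong : ∀ {a b} → a ≡ b mod N → residue a ≡ residue b
  residue-cong {a} {b} a≡b = Fin.toℕ-injective
    (trans (toℕ-residue a) (trans (%ℕ-cong {a} {b} a≡b) (sym (toℕ-residue b))))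

  residue-toℕ : ∀ i → residue (+ toℕ i) ≡ i
  residue-toℕ i = Fin.toℕ-injective
    (trans (toℕ-residue (+ toℕ i)) (%ℕ-unique {+ toℕ i} (Fin.toℕ<n i) (mod-reflexive {N} {+ toℕ i} refl)))

-- Labelings that are onto modulo N.

-- Pigeonhole: punching a missed value out of the codomain would leave an injection into a smaller
-- `Fin`.
injective⇒onto : ∀ {n} {f : Fin n → Fin n} → (∀ {i j} → f i ≡ f j → i ≡ j) → ∀ j → ∃[ i ] f i ≡ j
injective⇒onto {ℕ.suc n} {f} f-inj j with Fin.any? (λ i → f i Fin.≟ j)
... | yes hit = hit
... | no miss = contradiction
  (λ {i} {i′} eq → f-inj (Fin.punchOut-injective (j≢f i) (j≢f i′) eq)) (Fin.<⇒notInjective ℕ.≤-refl)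
  where
  j≢f : ∀ i → j ≢ f i
  j≢f i j≡fi = miss (i , sym j≡fi)

-- The only property established for each concrete labeling; on `N` vertices injectivity follows by
-- counting.
Onto : ∀ {V : Set} → ℕ → (V → ℤ) → Set
Onto N l = ∀ z → ∃[ v ] l v ≡ z mod N

module _ {N} .{{_ : NonZero N}} {l : Fin N → ℤ} (onto : Onto N l) where

  private
    position : Fin N → Fin N
    position i = residue N (l i)

    index : Fin N → Fin N
    index r = proj₁ (onto (+ toℕ r))

    position-index : ∀ r → position (index r) ≡ r
    position-index r =
      trans (residue-cong N {l (index r)} {+ toℕ r} (proj₂ (onto (+ toℕ r)))) (residue-toℕ N r)

    index-injective : ∀ {r s} → index r ≡ index s → r ≡ s
    index-injective {r} {s} eq =
      trans (sym (position-index r)) (trans (cong position eq) (position-index s))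

    -- A right inverse of `position` is injective, hence onto by pigeonhole, hence also a left
    -- inverse.
    index-position : ∀ i → index (position i) ≡ i
    index-position i = hit (injective⇒onto index-injective i)
      where
      hit : ∃[ r ] index r ≡ i → index (position i) ≡ i
      hit (r , refl) = cong index (position-index r)

  onto⇒injective : ∀ {i j} → l i ≡ l j mod N → i ≡ j
  onto⇒injective {i} {j} li≡lj =
    trans (sym (index-position i)) (trans (cong index (residue-cong N {l i} {l j} li≡lj)) (index-position j))

  module _ {c ℓ} (M : CommutativeMonoid c ℓ) where
    open CommutativeMonoid M using (Carrier; _≈_)
    private
      module M = CommutativeMonoid M
      module ΣM = CommutativeMonoidSum M

    -- The labels meet each residue class exactly once. The target is an arbitrary commutative
    -- monoid because the sums are needed both as exact integers and modulo `N`.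
    sum-reindex : (F : ℤ → Carrier) → (∀ {a b} → a ≡ b mod N → F a ≈ F b) →
                  ΣM.sum (F ∘ l) ≈ ΣM.sum (λ (r : Fin N) → F (+ toℕ r))
    sum-reindex F F-cong = M.trans
      (ΣM.sum-cong-≋ (λ i → F-cong {l i} {+ toℕ (position i)} (≡residue-mod N (l i))))
      (M.sym (ΣM.sum-permute (λ r → F (+ toℕ r))
        (permutation position index position-index index-position)))

-- Orientations from skew matrices.

module _ (G : SimpleGraph) where
  open SimpleGraph G

  onto⇒bijection : .{{_ : NonZero order}} {l : Vertex → ℤ} →
                   Onto order l → Bijection (setoid Vertex) (Mod.setoid order)
  onto⇒bijection {l} onto = record
    { to = l
    ; cong = λ { {v} refl → mod-reflexive {order} {l v} refl }
    ; bijective = injective , λ z → proj₁ (onto z) , λ { refl → proj₂ (onto z) }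
    }
    where
    open Inverse enum using (from; to; strictlyInverseˡ)

    onto-index : Onto order (l ∘ to)
    onto-index z with v , lv≡z ← onto z =
      from v , subst (λ w → l w ≡ z mod order) (sym (strictlyInverseˡ v)) lv≡z

    injective : ∀ {v w} → l v ≡ l w mod order → v ≡ w
    injective {v} {w} lv≡lw = begin
      v           ≡⟨ strictlyInverseˡ v ⟨
      to (from v) ≡⟨ cong to (onto⇒injective {l = l ∘ to} onto-index (subst₂ (λ v w → l v ≡ l w mod order)
                       (sym (strictlyInverseˡ v)) (sym (strictlyInverseˡ w)) lv≡lw)) ⟩
      to (from w) ≡⟨ strictlyInverseˡ w ⟩
      w           ∎
      where open ≡-Reasoning

  -- An orientation given by its skew adjacency matrix.
  module Skew
    (e : Vertex → Vertex → ℤ)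
    (skew : ∀ x y → e y x ≡ ℤ.- e x y)
    (adj⇒±1 : ∀ {x y} → Adj x y → e x y ≡ 1ℤ ⊎ e x y ≡ -1ℤ)
    (¬adj⇒0 : ∀ {x y} → ¬ Adj x y → e x y ≡ 0ℤ)
    where

    orientation : Orientation G
    orientation = record
      { Arc = λ x y → e x y ≡ 1ℤ
      ; arc? = λ x y → e x y ℤ.≟ 1ℤ
      ; arc⇒adj = arc⇒adj
      ; adj⇒arc = adj⇒arc
      ; asym = λ {x} {y} xy yx → contradiction (trans (sym yx) (trans (skew x y) (cong ℤ.-_ xy))) λ ()
      }
      where
      arc⇒adj : ∀ {x y} → e x y ≡ 1ℤ → Adj x y
      arc⇒adj {x} {y} xy with adj? x y
      ... | yes adj = adj
      ... | no ¬adj = contradiction (trans (sym xy) (¬adj⇒0 ¬adj)) λ ()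

      adj⇒arc : ∀ {x y} → Adj x y → e x y ≡ 1ℤ ⊎ e y x ≡ 1ℤ
      adj⇒arc {x} {y} adj with adj⇒±1 adj
      ... | inj₁ xy = inj₁ xy
      ... | inj₂ xy = inj₂ (trans (skew x y) (cong ℤ.-_ xy))

    open Orientation orientation using (N⁺?; N⁻?)

    -- A weight is an entry of the skew matrix applied to the label vector. The equality is exact,
    -- since `sumOver` in `ℤMod N` adds plain integers.
    weight≡sum : ∀ N (l : Vertex → ℤ) x →
      sumOver (ℤMod N) G (N⁺? x) l ℤ.- sumOver (ℤMod N) G (N⁻? x) l
      ≡ sum (λ i → e x (vertexAt i) ℤ.* l (vertexAt i))
    weight≡sum N l x = begin
      sum f ℤ.- sum g                             ≡⟨ sum-minus f g ⟨
      sum (λ i → f i ℤ.+ -1ℤ ℤ.* g i)             ≡⟨ sum-cong-≗ (λ i → term (vertexAt i) (l (vertexAt i))) ⟩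
      sum (λ i → e x (vertexAt i) ℤ.* l (vertexAt i)) ∎
      where
      open ≡-Reasoning
      f = λ i → if does (N⁺? x (vertexAt i)) then l (vertexAt i) else 0ℤ
      g = λ i → if does (N⁻? x (vertexAt i)) then l (vertexAt i) else 0ℤ

      term : ∀ y z →
        (if does (e x y ℤ.≟ 1ℤ) then z else 0ℤ) ℤ.+ -1ℤ ℤ.* (if does (e y x ℤ.≟ 1ℤ) then z else 0ℤ)
        ≡ e x y ℤ.* z
      term y z rewrite skew x y with adj? x y
      ... | no ¬adj rewrite ¬adj⇒0 ¬adj = refl
      ... | yes adj with adj⇒±1 adj
      ...   | inj₁ xy rewrite xy = plus z
        where
        plus : ∀ z → z ℤ.+ 0ℤ ≡ 1ℤ ℤ.* z
        plus = ℤ-Solver.solve-∀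
      ...   | inj₂ xy rewrite xy = ℤ.+-identityˡ (-1ℤ ℤ.* z)

    magic : .{{_ : NonZero order}} {l : Vertex → ℤ} → Onto order l → (μ : ℤ) →
            (∀ x → sum (λ i → e x (vertexAt i) ℤ.* l (vertexAt i)) ≡ μ mod order) →
            OrientableDistanceMagic (ℤMod order) G
    magic {l} onto μ sum≡μ = orientation , record
      { labeling = onto⇒bijection {l} onto
      ; magic = μ , λ x → subst (λ z → z ≡ μ mod order) (sym (weight≡sum order l x)) (sum≡μ x)
      }

-- Circulant orientations.

-- half∈part: labels differing by N/2 must lie in the same part, since N/2 = - N/2 leaves the
-- direction of an arc between them undetermined.
module Circulant (m n : ℕ) .{{_ : NonZero (m * n)}}
  (half∈part : ∀ r → r + r ≡ m * n → m ℕ.∣ r) where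

  N : ℕ
  N = m * n

  open SimpleGraph (K m ∘ₗ K̅ n) using (Vertex; Adj; vertexAt; enum)

  m∣N : + m ∣ + N
  m∣N = ∣ᵤ⇒∣ (ℕ.m∣m*n n)

  -- Off the multiples of `m`, this is 1 on residues below N/2 and -1 on those above; comparing `N`
  -- with twice the residue avoids halving. A residue equal to N/2 is a multiple of `m` by
  -- `half∈part`.
  ε : ℤ → ℤ
  ε d = if does (+ m ∣? d) then 0ℤ else sgn (+ N ℤ.- (+ (d %ℕ N) ℤ.+ + (d %ℕ N)))

  ε-0 : ∀ {d} → + m ∣ d → ε d ≡ 0ℤ
  ε-0 {d} m∣d rewrite dec-true (+ m ∣? d) m∣d = refl

  ε-sgn : ∀ {d} → ¬ + m ∣ d → ε d ≡ sgn (+ N ℤ.- (+ (d %ℕ N) ℤ.+ + (d %ℕ N)))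
  ε-sgn {d} m∤d rewrite dec-false (+ m ∣? d) m∤d = refl

  ∣residue⇒∣ : ∀ {d} → + m ∣ + (d %ℕ N) → + m ∣ d
  ∣residue⇒∣ {d} m∣r = subst (+ m ∣_) (cancel d _) (∣m∣n⇒∣m+n (∣-trans m∣N (≡%ℕ-mod N d)) m∣r)
    where
    cancel : ∀ d r → (d ℤ.- r) ℤ.+ r ≡ d
    cancel = ℤ-Solver.solve-∀

  ε-±1 : ∀ {d} → ¬ + m ∣ d → ε d ≡ 1ℤ ⊎ ε d ≡ -1ℤ
  ε-±1 {d} m∤d rewrite ε-sgn m∤d = sgn-±1 λ N-2r≡0 →
    m∤d (∣residue⇒∣ (∣ᵤ⇒∣ (half∈part (d %ℕ N) (sym (ℤ.+-injective (ℤ.i-j≡0⇒i≡j _ _ N-2r≡0))))))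

  ε-cong : ∀ {a b} → a ≡ b mod N → ε a ≡ ε b
  ε-cong {a} {b} a≡b = cong₂ (λ t r → if t then 0ℤ else sgn (+ N ℤ.- (+ r ℤ.+ + r)))
    (does-⇔ (mk⇔ (λ m∣a → subst (+ m ∣_) (swap a b) (∣m∣n⇒∣m-n m∣a (∣-trans m∣N a≡b)))
                 (λ m∣b → subst (+ m ∣_) (cancel a b) (∣m∣n⇒∣m+n (∣-trans m∣N a≡b) m∣b)))
            (+ m ∣? a) (+ m ∣? b))
    (%ℕ-cong N {a} {b} a≡b)
    where
    swap : ∀ a b → a ℤ.- (a ℤ.- b) ≡ b
    swap = ℤ-Solver.solve-∀
    cancel : ∀ a b → (a ℤ.- b) ℤ.+ b ≡ a
    cancel = ℤ-Solver.solve-∀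

  -- Negation sends a nonzero residue `r` to `N - r`, which changes the sign of `N - 2r`.
  ε-neg : ∀ d → ε (ℤ.- d) ≡ ℤ.- ε d
  ε-neg d with + m ∣? d
  ... | yes m∣d = trans (ε-0 (∣m⇒∣-m m∣d)) (cong ℤ.-_ (sym (ε-0 m∣d)))
  ... | no m∤d = begin
    ε (ℤ.- d)                                ≡⟨ ε-sgn (m∤d ∘ subst (+ m ∣_) (ℤ.neg-involutive d) ∘ ∣m⇒∣-m) ⟩
    sgn (+ N ℤ.- (+ r′ ℤ.+ + r′))            ≡⟨ cong (λ s → sgn (+ N ℤ.- (s ℤ.+ s))) +r′≡N-r ⟩
    sgn (+ N ℤ.- ((+ N ℤ.- + r) ℤ.+ (+ N ℤ.- + r))) ≡⟨ cong sgn (reflect (+ N) (+ r)) ⟩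
    sgn (ℤ.- (+ N ℤ.- (+ r ℤ.+ + r)))        ≡⟨ sgn-neg (+ N ℤ.- (+ r ℤ.+ + r)) ⟩
    ℤ.- sgn (+ N ℤ.- (+ r ℤ.+ + r))          ≡⟨ cong ℤ.-_ (ε-sgn m∤d) ⟨
    ℤ.- ε d                                  ∎
    where
    open ≡-Reasoning
    r = d %ℕ N
    r′ = (ℤ.- d) %ℕ N

    reflect : ∀ N r → N ℤ.- ((N ℤ.- r) ℤ.+ (N ℤ.- r)) ≡ ℤ.- (N ℤ.- (r ℤ.+ r))
    reflect = ℤ-Solver.solve-∀

    -- For `r` = 0 the residue of `- d` would be 0 instead of `N - r`.
    0<r : 0 < r
    0<r = ℕ.n≢0⇒n>0 λ r≡0 → m∤d (∣residue⇒∣ (subst (λ r → + m ∣ + r) (sym r≡0) (divides 0ℤ refl)))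

    N∸r≡N-r : + (N ∸ r) ≡ + N ℤ.- + r
    N∸r≡N-r = trans (sym (ℤ.⊖-≥ (ℕ.<⇒≤ (n%ℕd<d d N)))) (sym (ℤ.m-n≡m⊖n N r))

    -d≡N-r : ℤ.- d ≡ + (N ∸ r) mod N
    -d≡N-r = subst (+ N ∣_) (trans (eq d (+ r) (+ N)) (cong (λ z → ℤ.- d ℤ.- z) (sym N∸r≡N-r)))
      (∣m⇒∣-m (∣m∣n⇒∣m+n (≡%ℕ-mod N d) (divides 1ℤ (sym (ℤ.*-identityˡ (+ N))))))
      where
      eq : ∀ d r N → ℤ.- (d ℤ.- r ℤ.+ N) ≡ ℤ.- d ℤ.- (N ℤ.- r)
      eq = ℤ-Solver.solve-∀

    +r′≡N-r : + r′ ≡ + N ℤ.- + r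
    +r′≡N-r = trans (cong +_ (%ℕ-unique N {ℤ.- d} (ℕ.∸-monoʳ-< 0<r (ℕ.<⇒≤ (n%ℕd<d d N))) -d≡N-r)) N∸r≡N-r

  -- The part index is the low digit, so part `i` receives the residues congruent to `i` modulo `m`.
  l : Vertex → ℤ
  l (i , j) = + toℕ (combine j i)

  l-onto : Onto N l
  l-onto z with j , i , eq ← Fin.combine-surjective {n} {m} (Fin.cast (ℕ.*-comm m n) (residue N z)) =
    (i , j) , subst (λ x → + x ≡ z mod N) (sym toℕ-eq) (mod-sym {N} {z} (≡residue-mod N z))
    where
    toℕ-eq : toℕ (combine j i) ≡ toℕ (residue N z)
    toℕ-eq = trans (cong toℕ eq) (Fin.toℕ-cast (ℕ.*-comm m n) (residue N z))

  l-difference : ∀ i j i′ j′ →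
    l (i′ , j′) ℤ.- l (i , j) ≡ (+ toℕ j′ ℤ.- + toℕ j) ℤ.* + m ℤ.+ (+ toℕ i′ ℤ.- + toℕ i)
  l-difference i j i′ j′ = begin
    + toℕ (combine j′ i′) ℤ.- + toℕ (combine j i)
      ≡⟨ cong₂ (λ a b → + a ℤ.- + b) (Fin.toℕ-combine j′ i′) (Fin.toℕ-combine j i) ⟩
    + (m * toℕ j′) ℤ.+ + toℕ i′ ℤ.- (+ (m * toℕ j) ℤ.+ + toℕ i)
      ≡⟨ cong₂ (λ a b → a ℤ.+ + toℕ i′ ℤ.- (b ℤ.+ + toℕ i)) (ℤ.pos-* m (toℕ j′)) (ℤ.pos-* m (toℕ j)) ⟩
    + m ℤ.* + toℕ j′ ℤ.+ + toℕ i′ ℤ.- (+ m ℤ.* + toℕ j ℤ.+ + toℕ i)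
      ≡⟨ rearrange (+ m) (+ toℕ i) (+ toℕ j) (+ toℕ i′) (+ toℕ j′) ⟩
    (+ toℕ j′ ℤ.- + toℕ j) ℤ.* + m ℤ.+ (+ toℕ i′ ℤ.- + toℕ i) ∎
    where
    open ≡-Reasoning
    rearrange : ∀ m i j i′ j′ → m ℤ.* j′ ℤ.+ i′ ℤ.- (m ℤ.* j ℤ.+ i) ≡ (j′ ℤ.- j) ℤ.* m ℤ.+ (i′ ℤ.- i)
    rearrange = ℤ-Solver.solve-∀

  e : Vertex → Vertex → ℤ
  e x y = ε (l y ℤ.- l x)

  skew : ∀ x y → e y x ≡ ℤ.- e x y
  skew x y = trans (cong ε (flip (l x) (l y))) (ε-neg (l y ℤ.- l x))
    where
    flip : ∀ a b → a ℤ.- b ≡ ℤ.- (b ℤ.- a)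
    flip = ℤ-Solver.solve-∀

  adj⇒±1 : ∀ {x y} → Adj x y → e x y ≡ 1ℤ ⊎ e x y ≡ -1ℤ
  adj⇒±1 {i , j} {i′ , j′} (inj₁ i≢i′) = ε-±1 λ m∣d → i≢i′ (sym (Fin.toℕ-injective
    (residue-unique (Fin.toℕ<n i′) (Fin.toℕ<n i)
      (∣m+n∣m⇒∣n (subst (+ m ∣_) (l-difference i j i′ j′) m∣d) (divides (+ toℕ j′ ℤ.- + toℕ j) refl)))))

  ¬adj⇒0 : ∀ {x y} → ¬ Adj x y → e x y ≡ 0ℤ
  ¬adj⇒0 {i , j} {i′ , j′} ¬adj with i Fin.≟ i′
  ... | no i≢i′ = contradiction (inj₁ i≢i′) ¬adj
  ... | yes refl = ε-0 (divides (+ toℕ j′ ℤ.- + toℕ j)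
    (trans (l-difference i j i j′)
      (trans (cong (λ z → (+ toℕ j′ ℤ.- + toℕ j) ℤ.* + m ℤ.+ z) (ℤ.+-inverseʳ (+ toℕ i)))
        (ℤ.+-identityʳ _))))

  -- Negation permutes the residues and `ε` is odd, so the sum equals its own negative.
  sum-ε≡0 : sum (λ (r : Fin N) → ε (+ toℕ r)) ≡ 0ℤ
  sum-ε≡0 = ≡-neg⇒≡0 (begin
    sum ε⁺                       ≡⟨ sum-reindex {l = λ r → ℤ.- + toℕ r} neg-onto ℤ.+-0-commutativeMonoid
                                      ε (λ {a} {b} → ε-cong {a} {b}) ⟨
    sum ε⁻                       ≡⟨ sum-cong-≗ (λ r → trans (ε-neg (+ toℕ r)) (sym (ℤ.-1*i≡-i (ε⁺ r)))) ⟩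
    sum (λ r → -1ℤ ℤ.* ε⁺ r)     ≡⟨ *-distribˡ-sum -1ℤ ε⁺ ⟨
    -1ℤ ℤ.* sum ε⁺               ≡⟨ ℤ.-1*i≡-i (sum ε⁺) ⟩
    ℤ.- sum ε⁺                   ∎)
    where
    open ≡-Reasoning
    ε⁺ ε⁻ : Fin N → ℤ
    ε⁺ r = ε (+ toℕ r)
    ε⁻ r = ε (ℤ.- + toℕ r)

    neg-onto : Onto N (λ (r : Fin N) → ℤ.- + toℕ r)
    neg-onto z = residue N (ℤ.- z) , subst (+ N ∣_) (flip z _) (≡residue-mod N (ℤ.- z))
      where
      flip : ∀ z r → ℤ.- z ℤ.- r ≡ ℤ.- r ℤ.- z
      flip = ℤ-Solver.solve-∀

  μ : ℤ
  μ = sum (λ (r : Fin N) → ε (+ toℕ r) ℤ.* + toℕ r)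

  -- The differences `D` from the fixed label `l x` again run through all residues. Writing each
  -- label as a difference plus `l x` leaves `μ` and a multiple of the vanishing sum of `ε`.
  weight : ∀ x → sum (λ i → e x (vertexAt i) ℤ.* l (vertexAt i)) ≡ μ mod N
  weight x = subst (λ z → z ≡ μ mod N) (sym split)
    (sum-reindex {l = D} D-onto (Mod.commutativeMonoid N) (λ d → ε d ℤ.* d) (λ {a} {b} → term-cong {a} {b}))
    where
    open ≡-Reasoning
    D : Fin N → ℤ
    D i = l (vertexAt i) ℤ.- l x

    D-onto : Onto N D
    D-onto z with v , lv≡ ← l-onto (z ℤ.+ l x) =
      Inverse.from enum v , subst (+ N ∣_)
        (trans (shift (l v) z (l x))
          (cong (λ w → l w ℤ.- l x ℤ.- z) (sym (Inverse.strictlyInverseˡ enum v)))) lv≡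
      where
      shift : ∀ a z b → a ℤ.- (z ℤ.+ b) ≡ a ℤ.- b ℤ.- z
      shift = ℤ-Solver.solve-∀

    term-cong : ∀ {a b} → a ≡ b mod N → ε a ℤ.* a ≡ ε b ℤ.* b mod N
    term-cong {a} {b} a≡b rewrite ε-cong {a} {b} a≡b =
      subst (+ N ∣_) (distrib (ε b) a b) (∣n⇒∣m*n (ε b) a≡b)
      where
      distrib : ∀ s a b → s ℤ.* (a ℤ.- b) ≡ s ℤ.* a ℤ.- s ℤ.* b
      distrib = ℤ-Solver.solve-∀

    split : sum (λ i → e x (vertexAt i) ℤ.* l (vertexAt i)) ≡ sum (λ i → ε (D i) ℤ.* D i)
    split = begin
      sum (λ i → ε (D i) ℤ.* l (vertexAt i))
        ≡⟨ sum-cong-≗ (λ i → term (ε (D i)) (l (vertexAt i)) (l x)) ⟩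
      sum (λ i → ε (D i) ℤ.* D i ℤ.+ ε (D i) ℤ.* l x)
        ≡⟨ ∑-distrib-+ (λ i → ε (D i) ℤ.* D i) (λ i → ε (D i) ℤ.* l x) ⟩
      total ℤ.+ sum (λ i → ε (D i) ℤ.* l x)
        ≡⟨ cong (λ z → total ℤ.+ z) (*-distribʳ-sum (l x) (ε ∘ D)) ⟨
      total ℤ.+ sum (ε ∘ D) ℤ.* l x
        ≡⟨ cong (λ s → total ℤ.+ s ℤ.* l x)
        (trans (sum-reindex {l = D} D-onto ℤ.+-0-commutativeMonoid ε (λ {a} {b} → ε-cong {a} {b})) sum-ε≡0) ⟩
      total ℤ.+ 0ℤ                                          ≡⟨ ℤ.+-identityʳ total ⟩
      total                                                 ∎
      where
      total = sum (λ i → ε (D i) ℤ.* D i)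
      term : ∀ s a b → s ℤ.* a ≡ s ℤ.* (a ℤ.- b) ℤ.+ s ℤ.* b
      term = ℤ-Solver.solve-∀

  magic : OrientableDistanceMagic (ℤMod N) (K m ∘ₗ K̅ n)
  magic = Skew.magic (K m ∘ₗ K̅ n) e skew adj⇒±1 (λ {x} {y} → ¬adj⇒0 {x} {y}) {l = l} l-onto μ weight

-- Orientations twisted by vertex signs.

module SignedZeroSum {m n : ℕ} .{{_ : NonZero (m * n)}}
  (σ l : Fin m → Fin n → ℤ)
  (σ-±1 : ∀ i j → σ i j ≡ 1ℤ ⊎ σ i j ≡ -1ℤ)
  (l-onto : Onto (m * n) (λ ((i , j) : Fin m × Fin n) → l i j))
  (zero-sum : ∀ i → sum (λ j → σ i j ℤ.* l i j) ≡ 0ℤ)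
  where

  open SimpleGraph (K m ∘ₗ K̅ n) using (Vertex; Adj; vertexAt)

  -- The skew matrix of the transitive tournament on the parts.
  t : Fin m → Fin m → ℤ
  t i i′ = sgn (+ toℕ i′ ℤ.- + toℕ i)

  e : Vertex → Vertex → ℤ
  e (i , j) (i′ , j′) = t i i′ ℤ.* (σ i j ℤ.* σ i′ j′)

  skew : ∀ x y → e y x ≡ ℤ.- e x y
  skew (i , j) (i′ , j′) = begin
    t i′ i ℤ.* (σ i′ j′ ℤ.* σ i j)         ≡⟨ cong₂ ℤ._*_ t-skew (ℤ.*-comm (σ i′ j′) (σ i j)) ⟩
    ℤ.- t i i′ ℤ.* (σ i j ℤ.* σ i′ j′)     ≡⟨ ℤ.neg-distribˡ-* (t i i′) (σ i j ℤ.* σ i′ j′) ⟨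
    ℤ.- (t i i′ ℤ.* (σ i j ℤ.* σ i′ j′))   ∎
    where
    open ≡-Reasoning
    flip : ∀ a b → a ℤ.- b ≡ ℤ.- (b ℤ.- a)
    flip = ℤ-Solver.solve-∀
    t-skew : t i′ i ≡ ℤ.- t i i′
    t-skew = trans (cong sgn (flip (+ toℕ i) (+ toℕ i′))) (sgn-neg (+ toℕ i′ ℤ.- + toℕ i))

  *-±1 : ∀ {a b} → a ≡ 1ℤ ⊎ a ≡ -1ℤ → b ≡ 1ℤ ⊎ b ≡ -1ℤ → a ℤ.* b ≡ 1ℤ ⊎ a ℤ.* b ≡ -1ℤ
  *-±1 (inj₁ refl) (inj₁ refl) = inj₁ refl
  *-±1 (inj₁ refl) (inj₂ refl) = inj₂ refl
  *-±1 (inj₂ refl) (inj₁ refl) = inj₂ refl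
  *-±1 (inj₂ refl) (inj₂ refl) = inj₁ refl

  adj⇒±1 : ∀ {x y} → Adj x y → e x y ≡ 1ℤ ⊎ e x y ≡ -1ℤ
  adj⇒±1 {i , j} {i′ , j′} (inj₁ i≢i′) = *-±1
    (sgn-±1 λ i′-i≡0 → i≢i′ (sym (Fin.toℕ-injective (ℤ.+-injective (ℤ.i-j≡0⇒i≡j _ _ i′-i≡0)))))
    (*-±1 (σ-±1 i j) (σ-±1 i′ j′))

  ¬adj⇒0 : ∀ {x y} → ¬ Adj x y → e x y ≡ 0ℤ
  ¬adj⇒0 {i , j} {i′ , j′} ¬adj with i Fin.≟ i′
  ... | no i≢i′ = contradiction (inj₁ i≢i′) ¬adj
  ... | yes refl = cong (λ d → sgn d ℤ.* (σ i j ℤ.* σ i j′)) (ℤ.+-inverseʳ (+ toℕ i))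

  l′ : Vertex → ℤ
  l′ (i , j) = l i j

  weight≡0 : ∀ x → sum (λ k → e x (vertexAt k) ℤ.* l′ (vertexAt k)) ≡ 0ℤ
  weight≡0 x@(i , j) = begin
    sum (λ k → e x (vertexAt k) ℤ.* l′ (vertexAt k))
      ≡⟨ sum-vertices m n (λ y → e x y ℤ.* l′ y) ⟩
    sum (λ i′ → sum (λ j′ → e x (i′ , j′) ℤ.* l i′ j′))
      ≡⟨ sum-cong-≗ part≡0 ⟩
    sum (λ (_ : Fin m) → 0ℤ)
      ≡⟨ sum-replicate-zero m ⟩
    0ℤ ∎
    where
    open ≡-Reasoning
    assoc : ∀ t s s′ a → t ℤ.* (s ℤ.* s′) ℤ.* a ≡ t ℤ.* s ℤ.* (s′ ℤ.* a)
    assoc = ℤ-Solver.solve-∀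

    -- The factors `t i i′` and `σ i j` are constant along a part and leave its signed label sum.
    part≡0 : ∀ i′ → sum (λ j′ → e x (i′ , j′) ℤ.* l i′ j′) ≡ 0ℤ
    part≡0 i′ = begin
      sum (λ j′ → e x (i′ , j′) ℤ.* l i′ j′)
        ≡⟨ sum-cong-≗ (λ j′ → assoc (t i i′) (σ i j) (σ i′ j′) (l i′ j′)) ⟩
      sum (λ j′ → t i i′ ℤ.* σ i j ℤ.* (σ i′ j′ ℤ.* l i′ j′))
        ≡⟨ *-distribˡ-sum (t i i′ ℤ.* σ i j) (λ j′ → σ i′ j′ ℤ.* l i′ j′) ⟨
      t i i′ ℤ.* σ i j ℤ.* sum (λ j′ → σ i′ j′ ℤ.* l i′ j′)
        ≡⟨ cong (t i i′ ℤ.* σ i j ℤ.*_) (zero-sum i′) ⟩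
      t i i′ ℤ.* σ i j ℤ.* 0ℤ
        ≡⟨ ℤ.*-zeroʳ (t i i′ ℤ.* σ i j) ⟩
      0ℤ ∎

  magic : OrientableDistanceMagic (ℤMod (m * n)) (K m ∘ₗ K̅ n)
  magic = Skew.magic (K m ∘ₗ K̅ n) e skew
    (λ {x} {y} → adj⇒±1 {x} {y}) (λ {x} {y} → ¬adj⇒0 {x} {y}) {l = l′} l-onto 0ℤ
    (λ x → mod-reflexive {m * n} (weight≡0 x))

-- Signed zero-sum parts when 4 divides m.

-- Iterated, this reduces surjectivity onto an initial segment to one subinterval at a time.
cover-+ : ∀ {p} a {b} (P : ℕ → Set p) → (∀ (i : Fin a) → P (toℕ i)) → (∀ (j : Fin b) → P (a + toℕ j)) →
          ∀ (x : Fin (a + b)) → P (toℕ x)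
cover-+ a {b} P low high x with Fin.splitAt a x in eq
... | inj₁ i = subst P (trans (sym (Fin.toℕ-↑ˡ i b)) (cong toℕ (Fin.splitAt⁻¹-↑ˡ eq))) (low i)
... | inj₂ j = subst P (trans (sym (Fin.toℕ-↑ʳ a j)) (cong toℕ (Fin.splitAt⁻¹-↑ʳ eq))) (high j)

suc[i+opposite]≡n : ∀ {n} (i : Fin n) → ℕ.suc (toℕ i + toℕ (opposite i)) ≡ n
suc[i+opposite]≡n i = trans (cong (λ o → ℕ.suc (toℕ i + o)) (Fin.opposite-prop i)) (ℕ.m+[n∸m]≡n (Fin.toℕ<n i))

-- The part numbered i = 2u + b consists of three labels with signed sum 3h, namely
--   b = 0:            (h + u) - (2h + i) + (4h + u),
--   b = 1, u < k:     - u + (2h + i) + (h - 1 - u),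
--   b = 1, u ≥ k:     - (5h + u) + (2h + i) + (6h - 1 - u),
-- and of r pairs of consecutive labels from 6h on, each with signed sum 1.  The signs of a
-- part add up to 1, so lowering all labels by 3h + r makes every signed part sum 0.
module FourDivides (k r : ℕ) .{{_ : NonZero ((k + k) * 2 * (3 + r * 2))}} where

  h m n : ℕ
  h = k + k
  m = h * 2
  n = 3 + r * 2

  -- Reflection of `Fin h` exchanges its lower and upper half. Hence `u` and its opposite fill all
  -- of [0, h) as `u` runs over the lower half, and the same pairs moved up by 5h fill [5h, 6h) as
  -- `u` runs over the upper half.
  outer : Fin h → ℕ → ℕ
  outer u x = if does (toℕ u ℕ.<? k) then x else h + (h + (m + (h + x)))

  -- The offsets are nested so that hit-all can peel them off one interval at a time.
  label : Fin n → Fin h × Fin 2 → ℕ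
  label 0F (u , 0F) = h + toℕ u
  label 0F (u , 1F) = outer u (toℕ u)
  label 1F (u , b)  = h + (h + toℕ (combine u b))
  label 2F (u , 0F) = h + (h + (m + toℕ u))
  label 2F (u , 1F) = outer u (toℕ (opposite u))
  label (suc (suc (suc t))) (u , b) = let p , c = remQuot {r} 2 t in
    h + (h + (m + (h + (h + toℕ (combine p (combine (combine u b) c))))))

  alternating : Fin 2 → ℤ
  alternating 0F = -1ℤ
  alternating 1F = 1ℤ

  sign : Fin n → Fin 2 → ℤ
  sign 0F 0F = 1ℤ
  sign 0F 1F = -1ℤ
  sign 1F 0F = -1ℤ
  sign 1F 1F = 1ℤ
  sign 2F _  = 1ℤ
  sign (suc (suc (suc t))) _ = alternating (proj₂ (remQuot {r} 2 t))

  shift : ℤ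
  shift = + (h + h + h + r)

  σ l : Fin m → Fin n → ℤ
  σ i j = sign j (proj₂ (remQuot {h} 2 i))
  l i j = + label j (remQuot 2 i) ℤ.- shift

  σ-±1 : ∀ i j → σ i j ≡ 1ℤ ⊎ σ i j ≡ -1ℤ
  σ-±1 i j = sign-±1 j (proj₂ (remQuot {h} 2 i))
    where
    alternating-±1 : ∀ c → alternating c ≡ 1ℤ ⊎ alternating c ≡ -1ℤ
    alternating-±1 0F = inj₂ refl
    alternating-±1 1F = inj₁ refl

    sign-±1 : ∀ j b → sign j b ≡ 1ℤ ⊎ sign j b ≡ -1ℤ
    sign-±1 0F 0F = inj₁ refl
    sign-±1 0F 1F = inj₂ refl
    sign-±1 1F 0F = inj₂ refl
    sign-±1 1F 1F = inj₁ refl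
    sign-±1 2F _  = inj₁ refl
    sign-±1 (suc (suc (suc t))) _ = alternating-±1 (proj₂ (remQuot {r} 2 t))

  outer-< : ∀ {u x} → toℕ u < k → outer u x ≡ x
  outer-< {u} u<k rewrite dec-true (toℕ u ℕ.<? k) u<k = refl

  outer-≮ : ∀ {u x} → ¬ toℕ u < k → outer u x ≡ h + (h + (m + (h + x)))
  outer-≮ {u} u≮k rewrite dec-false (toℕ u ℕ.<? k) u≮k = refl

  opposite-< : ∀ {u : Fin h} → ¬ toℕ u < k → toℕ (opposite u) < k
  opposite-< {u} u≮k = ℕ.≰⇒> λ k≤o → ℕ.<-irrefl (sym (suc[i+opposite]≡n u))
    (s≤s (ℕ.+-mono-≤ (ℕ.≮⇒≥ u≮k) k≤o))

  opposite-≮ : ∀ {u : Fin h} → toℕ u < k → ¬ toℕ (opposite u) < k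
  opposite-≮ {u} u<k o<k = ℕ.<-irrefl (suc[i+opposite]≡n u)
    (subst (_≤ h) (ℕ.+-suc (ℕ.suc (toℕ u)) (toℕ (opposite u))) (ℕ.+-mono-≤ u<k o<k))

  Hit : ℕ → Set
  Hit x = ∃[ w ] ∃[ j ] label j w ≡ x

  size : h + (h + (m + (h + (h + r * (m * 2))))) ≡ m * n
  size = eq h r
    where
    eq : ∀ h r → h + (h + (h * 2 + (h + (h + r * (h * 2 * 2))))) ≡ h * 2 * (3 + r * 2)
    eq = ℕ-Solver.solve-∀

  -- The intervals starting at 0, h, 2h, 4h, 5h and 6h are filled in turn by the small `outer`
  -- labels, the first labels for `b` = 0, the middle labels, the third labels for `b` = 0, the
  -- large `outer` labels, and the pairs.
  hit-all : ∀ (x : Fin (h + (h + (m + (h + (h + r * (m * 2))))))) → Hit (toℕ x)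
  hit-all = cover-+ h Hit low
    (cover-+ h (λ x → Hit (h + x)) (λ u → (u , 0F) , 0F , refl)
    (cover-+ m (λ x → Hit (h + (h + x))) middle
    (cover-+ h (λ x → Hit (h + (h + (m + x)))) (λ u → (u , 0F) , 2F , refl)
    (cover-+ h (λ x → Hit (h + (h + (m + (h + x))))) high tail))))
    where
    low : ∀ (u : Fin h) → Hit (toℕ u)
    low u with toℕ u ℕ.<? k
    ... | yes u<k = (u , 1F) , 0F , outer-< u<k
    -- The opposite index lies in the lower half, and its third label reflects back to `u`.
    ... | no  u≮k = (opposite u , 1F) , 2F ,
      trans (outer-< (opposite-< u≮k)) (cong toℕ (Fin.opposite-involutive u))

    middle : ∀ (i : Fin m) → Hit (h + (h + toℕ i))
    middle i with u , b , refl ← Fin.combine-surjective {h} {2} i = (u , b) , 1F , refl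

    high : ∀ (u : Fin h) → Hit (h + (h + (m + (h + toℕ u))))
    high u with toℕ u ℕ.<? k
    ... | no  u≮k = (u , 1F) , 0F , outer-≮ u≮k
    ... | yes u<k = (opposite u , 1F) , 2F ,
      trans (outer-≮ (opposite-≮ u<k)) (cong (λ v → h + (h + (m + (h + toℕ v)))) (Fin.opposite-involutive u))

    tail : ∀ (x : Fin (r * (m * 2))) → Hit (h + (h + (m + (h + (h + toℕ x)))))
    tail x
      with p , y , refl ← Fin.combine-surjective {r} {m * 2} x
      with i , c , refl ← Fin.combine-surjective {m} {2} y
      with u , b , refl ← Fin.combine-surjective {h} {2} i =
      (u , b) , suc (suc (suc (combine p c))) ,
      cong (λ (p , c) → h + (h + (m + (h + (h + toℕ (combine p (combine (combine u b) c)))))))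
        (Fin.remQuot-combine {r} {2} p c)

  l-onto : Onto (m * n) (λ ((i , j) : Fin m × Fin n) → l i j)
  l-onto z with w@(u , b) , j , label≡ ← hit-all (Fin.cast (sym size) (residue (m * n) (z ℤ.+ shift))) =
    (combine u b , j) , subst (+ (m * n) ∣_) l-eq
      (mod-sym {m * n} {z ℤ.+ shift} (≡residue-mod (m * n) (z ℤ.+ shift)))
    where
    open ≡-Reasoning
    rearrange : ∀ x z s → x ℤ.- (z ℤ.+ s) ≡ x ℤ.- s ℤ.- z
    rearrange = ℤ-Solver.solve-∀

    label-eq : toℕ (residue (m * n) (z ℤ.+ shift)) ≡ label j (remQuot 2 (combine u b))
    label-eq = trans (sym (Fin.toℕ-cast (sym size) _))
      (trans (sym label≡) (cong (λ w → label j w) (sym (Fin.remQuot-combine u b))))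

    l-eq : + toℕ (residue (m * n) (z ℤ.+ shift)) ℤ.- (z ℤ.+ shift) ≡ l (combine u b) j ℤ.- z
    l-eq = trans (rearrange (+ toℕ (residue (m * n) (z ℤ.+ shift))) z shift)
      (cong (λ x → + x ℤ.- shift ℤ.- z) label-eq)

  -- With `c` as lowest digit the two labels of a pair are consecutive; their signs -1 and 1 cancel
  -- the shift, so each pair contributes 1.
  tail-sum : ∀ w → sum (λ (t : Fin (r * 2)) →
    sign (suc (suc (suc t))) (proj₂ w) ℤ.* (+ label (suc (suc (suc t))) w ℤ.- shift)) ≡ + r
  tail-sum w@(u , b) = begin
    sum (λ (t : Fin (r * 2)) → term (remQuot {r} 2 t))
      ≡⟨ sum-combine r (λ (t : Fin (r * 2)) → term (remQuot {r} 2 t)) ⟩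
    sum (λ (p : Fin r) → sum (λ (c : Fin 2) → term (remQuot {r} 2 (combine p c))))
      ≡⟨ sum-cong-≗ pair ⟩
    sum (λ (_ : Fin r) → 1ℤ)
      ≡⟨ sum-ones r ⟩
    + r ∎
    where
    open ≡-Reasoning
    tailLabel : Fin r → Fin 2 → ℕ
    tailLabel p c = h + (h + (m + (h + (h + toℕ (combine p (combine (combine u b) c))))))

    term : Fin r × Fin 2 → ℤ
    term (p , c) = alternating c ℤ.* (+ tailLabel p c ℤ.- shift)

    expand : ∀ p c →
      tailLabel p c ≡ h + (h + (m + (h + (h + (m * 2 * toℕ p + (2 * toℕ (combine u b) + toℕ c))))))
    expand p c = cong (λ x → h + (h + (m + (h + (h + x)))))
      (trans (Fin.toℕ-combine p (combine (combine u b) c))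
        (cong (λ y → m * 2 * toℕ p + y) (Fin.toℕ-combine (combine u b) c)))

    consecutive : ∀ p → tailLabel p 1F ≡ 1 + tailLabel p 0F
    consecutive p = trans (expand p 1F)
      (trans (eq h m (m * 2 * toℕ p) (2 * toℕ (combine u b))) (cong ℕ.suc (sym (expand p 0F))))
      where
      eq : ∀ h m x y → h + (h + (m + (h + (h + (x + (y + 1))))))
           ≡ 1 + (h + (h + (m + (h + (h + (x + (y + 0)))))))
      eq = ℕ-Solver.solve-∀

    pair : ∀ p → sum (λ (c : Fin 2) → term (remQuot {r} 2 (combine p c))) ≡ 1ℤ
    pair p = begin
      sum (λ (c : Fin 2) → term (remQuot {r} 2 (combine p c)))
        ≡⟨ sum-cong-≗ (λ c → cong term (Fin.remQuot-combine {r} {2} p c)) ⟩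
      -1ℤ ℤ.* (+ tailLabel p 0F ℤ.- shift) ℤ.+ (1ℤ ℤ.* (+ tailLabel p 1F ℤ.- shift) ℤ.+ 0ℤ)
        ≡⟨ cong (λ y → -1ℤ ℤ.* (+ tailLabel p 0F ℤ.- shift) ℤ.+ (1ℤ ℤ.* (+ y ℤ.- shift) ℤ.+ 0ℤ))
             (consecutive p) ⟩
      -1ℤ ℤ.* (+ tailLabel p 0F ℤ.- shift) ℤ.+ (1ℤ ℤ.* (1ℤ ℤ.+ + tailLabel p 0F ℤ.- shift) ℤ.+ 0ℤ)
        ≡⟨ eq (+ tailLabel p 0F) shift ⟩
      1ℤ ∎
      where
      eq : ∀ x s → -1ℤ ℤ.* (x ℤ.- s) ℤ.+ (1ℤ ℤ.* (1ℤ ℤ.+ x ℤ.- s) ℤ.+ 0ℤ) ≡ 1ℤ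
      eq = ℤ-Solver.solve-∀

  toℕ-combine₂ : ∀ (u : Fin h) (b : Fin 2) → toℕ (combine u b) ≡ toℕ u + toℕ u + toℕ b
  toℕ-combine₂ u b = trans (Fin.toℕ-combine u b) (double (toℕ u) (toℕ b))
    where
    double : ∀ u b → 2 * u + b ≡ u + u + b
    double = ℕ-Solver.solve-∀

  outer-difference : ∀ u x y → + outer u y ℤ.- + outer u x ≡ + y ℤ.- + x
  outer-difference u x y with does (toℕ u ℕ.<? k)
  ... | true  = refl
  ... | false = cancel (+ h) (+ m) (+ x) (+ y)
    where
    cancel : ∀ h m x y → h ℤ.+ (h ℤ.+ (m ℤ.+ (h ℤ.+ y))) ℤ.- (h ℤ.+ (h ℤ.+ (m ℤ.+ (h ℤ.+ x)))) ≡ y ℤ.- x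
    cancel = ℤ-Solver.solve-∀

  part-sum : ∀ w → sum (λ j → sign j (proj₂ w) ℤ.* (+ label j w ℤ.- shift)) ≡ 0ℤ
  part-sum (u , 0F) = begin
    total (+ c) (+ m) _                              ≡⟨ cong (total (+ c) (+ m)) (tail-sum (u , 0F)) ⟩
    total (+ c) (+ m) (+ r)
      ≡⟨ cong₂ (λ c m → total (+ c) (+ m) (+ r)) (toℕ-combine₂ u 0F) (double h) ⟩
    total (+ (toℕ u + toℕ u + 0)) (+ (h + h)) (+ r)                   ≡⟨ eq (+ h) (+ toℕ u) (+ r) ⟩
    0ℤ                                                                ∎
    where
    open ≡-Reasoning
    c = toℕ (combine {n = 2} u 0F)

    total : ℤ → ℤ → ℤ → ℤ
    total c m s = 1ℤ ℤ.* (+ (h + toℕ u) ℤ.- shift) ℤ.+ (-1ℤ ℤ.* ((+ h ℤ.+ (+ h ℤ.+ c)) ℤ.- shift) ℤ.+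
      (1ℤ ℤ.* ((+ h ℤ.+ (+ h ℤ.+ (m ℤ.+ + toℕ u))) ℤ.- shift) ℤ.+ s))

    double : ∀ h → h * 2 ≡ h + h
    double = ℕ-Solver.solve-∀

    eq : ∀ h u r → let s = h ℤ.+ h ℤ.+ h ℤ.+ r in
      1ℤ ℤ.* ((h ℤ.+ u) ℤ.- s) ℤ.+ (-1ℤ ℤ.* ((h ℤ.+ (h ℤ.+ (u ℤ.+ u ℤ.+ 0ℤ))) ℤ.- s) ℤ.+
        (1ℤ ℤ.* ((h ℤ.+ (h ℤ.+ ((h ℤ.+ h) ℤ.+ u))) ℤ.- s) ℤ.+ r)) ≡ 0ℤ
    eq = ℤ-Solver.solve-∀
  part-sum (u , 1F) = begin
    total (+ c) _                              ≡⟨ cong (total (+ c)) (tail-sum (u , 1F)) ⟩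
    total (+ c) (+ r)                          ≡⟨ cong (λ c → total (+ c) (+ r)) (toℕ-combine₂ u 1F) ⟩
    total (+ (toℕ u + toℕ u + 1)) (+ r)
      ≡⟨ eq (+ h) (+ toℕ u) (+ o) (+ outer u (toℕ u)) (+ outer u o) (+ r) ⟩
    -- Both brackets vanish: the two `outer` labels carry the same offset, and `u` and its opposite
    -- add up to `h - 1`.
    (+ outer u o ℤ.- + outer u (toℕ u) ℤ.- (+ o ℤ.- + toℕ u)) ℤ.+ (+ ℕ.suc (toℕ u + o) ℤ.- + h)
      ≡⟨ cong₂ ℤ._+_ (ℤ.i≡j⇒i-j≡0 (outer-difference u (toℕ u) o))
           (ℤ.i≡j⇒i-j≡0 (cong +_ (suc[i+opposite]≡n u))) ⟩
    0ℤ                                                          ∎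
    where
    open ≡-Reasoning
    c = toℕ (combine {n = 2} u 1F)
    o = toℕ (opposite u)

    total : ℤ → ℤ → ℤ
    total c s = -1ℤ ℤ.* (+ outer u (toℕ u) ℤ.- shift) ℤ.+ (1ℤ ℤ.* ((+ h ℤ.+ (+ h ℤ.+ c)) ℤ.- shift) ℤ.+
      (1ℤ ℤ.* (+ outer u o ℤ.- shift) ℤ.+ s))

    eq : ∀ h u o a c r → let s = h ℤ.+ h ℤ.+ h ℤ.+ r in
      -1ℤ ℤ.* (a ℤ.- s) ℤ.+ (1ℤ ℤ.* ((h ℤ.+ (h ℤ.+ (u ℤ.+ u ℤ.+ 1ℤ))) ℤ.- s) ℤ.+ (1ℤ ℤ.* (c ℤ.- s) ℤ.+ r))
      ≡ (c ℤ.- a ℤ.- (o ℤ.- u)) ℤ.+ (1ℤ ℤ.+ (u ℤ.+ o) ℤ.- h)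
    eq = ℤ-Solver.solve-∀

  magic : OrientableDistanceMagic (ℤMod (m * n)) (K m ∘ₗ K̅ n)
  magic = SignedZeroSum.magic σ l σ-±1 l-onto (λ i → part-sum (remQuot 2 i))

-- The parity obstruction.

odd∤ : ∀ {z} q → z ≡ + 2 ℤ.* q ℤ.+ 1ℤ → ¬ + 2 ∣ z
odd∤ {z} q z≡2q+1 2∣z = 2∤1
  (∣m+n∣m⇒∣n {+ 2} {+ 2 ℤ.* q} (subst (+ 2 ∣_) z≡2q+1 2∣z) (divides q (ℤ.*-comm (+ 2) q)))
  where
  2∤1 : ¬ + 2 ∣ 1ℤ
  2∤1 2∣1 = contradiction (∣⇒∣ᵤ 2∣1) (ℕ.>⇒∤ (s≤s (s≤s z≤n)))

-- Parity is well defined on classes modulo an even `N`. The modulus is kept separate from `m * n`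
-- so that `K m ∘ₗ K̅ 1` with modulus `m` is covered directly.
module Parity {m n N : ℕ} (2∣N : + 2 ∣ + N) (0<n : 0 < n)
  (odm : OrientableDistanceMagic (ℤMod N) (K m ∘ₗ K̅ n)) where

  open SimpleGraph (K m ∘ₗ K̅ n) using (Vertex; vertexAt)
  open Orientation (proj₁ odm)
  open DirectedDistanceMagicLabeling (proj₂ odm) using (l; magic)

  μ : ℤ
  μ = proj₁ magic

  partSum : Fin m → ℤ
  partSum i = sum (λ j → l (i , j))

  total : ℤ
  total = sum (λ k → l (vertexAt k))

  total≡sum-partSum : total ≡ sum partSum
  total≡sum-partSum = sum-vertices m n l

  -- Modulo 2 an arc counts the same in both directions, and exactly one arc joins `x` to each
  -- vertex outside its part. So `y` contributes `l y` outside the part of `x` and 0 inside.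
  term-parity : ∀ x y → + 2 ∣
    ((if does (N⁺? x y) then l y else 0ℤ) ℤ.+ -1ℤ ℤ.* (if does (N⁻? x y) then l y else 0ℤ))
      ℤ.+ -1ℤ ℤ.* (l y ℤ.+ -1ℤ ℤ.* (δ (proj₁ x) (proj₁ y) ℤ.* l y))
  term-parity x@(i , _) y@(i′ , _) with N⁺? x y | N⁻? x y | i Fin.≟ i′
  ... | yes xy | yes yx | _        = contradiction yx (asym xy)
  ... | yes xy | no _   | no _     = divides 0ℤ (eq (l y))
    where
    eq : ∀ a → (a ℤ.+ -1ℤ ℤ.* 0ℤ) ℤ.+ -1ℤ ℤ.* (a ℤ.+ -1ℤ ℤ.* (0ℤ ℤ.* a)) ≡ 0ℤ ℤ.* + 2
    eq = ℤ-Solver.solve-∀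
  ... | no _   | yes yx | no _     = divides (ℤ.- l y) (eq (l y))
    where
    eq : ∀ a → (0ℤ ℤ.+ -1ℤ ℤ.* a) ℤ.+ -1ℤ ℤ.* (a ℤ.+ -1ℤ ℤ.* (0ℤ ℤ.* a)) ≡ ℤ.- a ℤ.* + 2
    eq = ℤ-Solver.solve-∀
  ... | no _   | no _   | yes _    = divides 0ℤ (eq (l y))
    where
    eq : ∀ a → (0ℤ ℤ.+ -1ℤ ℤ.* 0ℤ) ℤ.+ -1ℤ ℤ.* (a ℤ.+ -1ℤ ℤ.* (1ℤ ℤ.* a)) ≡ 0ℤ ℤ.* + 2
    eq = ℤ-Solver.solve-∀
  ... | yes xy | no _   | yes refl = contradiction (arc⇒adj xy) λ { (inj₁ i≢i) → i≢i refl; (inj₂ (_ , ())) }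
  ... | no _   | yes yx | yes refl = contradiction (arc⇒adj yx) λ { (inj₁ i≢i) → i≢i refl; (inj₂ (_ , ())) }
  ... | no ¬xy | no ¬yx | no i≢i′  with adj⇒arc {x} {y} (inj₁ i≢i′)
  ...   | inj₁ xy = contradiction xy ¬xy
  ...   | inj₂ yx = contradiction yx ¬yx

  own-part : ∀ i → sum (λ k → δ i (proj₁ (vertexAt k)) ℤ.* l (vertexAt k)) ≡ partSum i
  own-part i = begin
    sum (λ k → δ i (proj₁ (vertexAt k)) ℤ.* l (vertexAt k))
      ≡⟨ sum-vertices m n (λ y → δ i (proj₁ y) ℤ.* l y) ⟩
    sum (λ i′ → sum (λ j → δ i i′ ℤ.* l (i′ , j)))
      ≡⟨ sum-cong-≗ (λ i′ → *-distribˡ-sum (δ i i′) (λ j → l (i′ , j))) ⟨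
    sum (λ i′ → δ i i′ ℤ.* partSum i′)
      ≡⟨ sum-δ i partSum ⟩
    partSum i ∎
    where open ≡-Reasoning

  -- Summed over all `y`, `term-parity` makes the weight of a vertex of part `i` congruent to
  -- `total - partSum i` modulo 2, while magic makes it congruent to `μ`. The parity is thus
  -- independent of `i`.
  partSum-parity : ∀ i → + 2 ∣ partSum i ℤ.- (total ℤ.- μ)
  partSum-parity i = subst (+ 2 ∣_) (eq (outS ℤ.- inS) total (partSum i) μ)
    (∣m∣n⇒∣m-n (subst (+ 2 ∣_) sum-eq (∣-sum (λ k → term-parity x (vertexAt k))))
      (∣-trans 2∣N (proj₂ magic x)))
    where
    open ≡-Reasoning
    x : Vertex
    x = i , fromℕ< 0<n

    out in′ own : Fin (m * n) → ℤ
    out k = if does (N⁺? x (vertexAt k)) then l (vertexAt k) else 0ℤ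
    in′ k = if does (N⁻? x (vertexAt k)) then l (vertexAt k) else 0ℤ
    own k = δ i (proj₁ (vertexAt k)) ℤ.* l (vertexAt k)

    outS inS : ℤ
    outS = sum out
    inS = sum in′

    sum-eq : sum (λ k → (out k ℤ.+ -1ℤ ℤ.* in′ k) ℤ.+ -1ℤ ℤ.* (l (vertexAt k) ℤ.+ -1ℤ ℤ.* own k))
             ≡ (outS ℤ.- inS) ℤ.- (total ℤ.- partSum i)
    sum-eq = begin
      sum (λ k → (out k ℤ.+ -1ℤ ℤ.* in′ k) ℤ.+ -1ℤ ℤ.* (l (vertexAt k) ℤ.+ -1ℤ ℤ.* own k))
        ≡⟨ sum-minus (λ k → out k ℤ.+ -1ℤ ℤ.* in′ k) (λ k → l (vertexAt k) ℤ.+ -1ℤ ℤ.* own k) ⟩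
      sum (λ k → out k ℤ.+ -1ℤ ℤ.* in′ k) ℤ.- sum (λ k → l (vertexAt k) ℤ.+ -1ℤ ℤ.* own k)
        ≡⟨ cong₂ ℤ._-_ (sum-minus out in′)
             (trans (sum-minus (l ∘ vertexAt) own) (cong (λ z → total ℤ.- z) (own-part i))) ⟩
      (outS ℤ.- inS) ℤ.- (total ℤ.- partSum i) ∎

    eq : ∀ w t s μ → (w ℤ.- (t ℤ.- s)) ℤ.- (w ℤ.- μ) ≡ s ℤ.- (t ℤ.- μ)
    eq = ℤ-Solver.solve-∀

-- Part sums of singletons are labels, so all labels share one parity, yet 0 and 1 both occur.
¬magic-n≡1 : ∀ {q} → ¬ OrientableDistanceMagic (ℤMod (q * 2)) (K (q * 2) ∘ₗ K̅ 1)
¬magic-n≡1 {q} odm = 0≢1 (preimage 0ℤ) (preimage 1ℤ)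
  where
  open DirectedDistanceMagicLabeling (proj₂ odm) using (l; labeling)
  2∣N : + 2 ∣ + (q * 2)
  2∣N = ∣ᵤ⇒∣ (ℕ.n∣m*n q)
  open Parity {q * 2} {1} 2∣N (s≤s z≤n) odm using (μ; total; partSum-parity)

  preimage : ∀ z → ∃[ v ] l v ≡ z mod (q * 2)
  preimage z = let v , to≡z = Bijection.surjective labeling z in v , to≡z refl

  0≢1 : ∃[ v ] l v ≡ 0ℤ mod (q * 2) → ¬ (∃[ w ] l w ≡ 1ℤ mod (q * 2))
  0≢1 ((i , 0F) , lv≡0) ((i′ , 0F) , lw≡1) = odd∤ 0ℤ refl (subst (+ 2 ∣_)
    (eq (l (i , 0F)) (l (i′ , 0F)) (total ℤ.- μ))
    (∣m∣n⇒∣m-n (∣m∣n⇒∣m-n (∣-trans 2∣N lv≡0) (∣-trans 2∣N lw≡1))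
      (∣m∣n⇒∣m-n (partSum-parity i) (partSum-parity i′))))
    where
    -- `a + 0ℤ` is the sum over a part with one vertex.
    eq : ∀ a b c → ((a ℤ.- 0ℤ) ℤ.- (b ℤ.- 1ℤ)) ℤ.- ((a ℤ.+ 0ℤ ℤ.- c) ℤ.- (b ℤ.+ 0ℤ ℤ.- c)) ≡ 1ℤ
    eq = ℤ-Solver.solve-∀

¬magic-2mod4 : ∀ {a b} (let m = 2 + a * 4; n = 1 + b * 2) →
                ¬ OrientableDistanceMagic (ℤMod (m * n)) (K m ∘ₗ K̅ n)
¬magic-2mod4 {a} {b} odm = odd∤ ((+ 4 ℤ.* + c ℤ.+ + 3) ℤ.* + c) residues-sum-odd 2∣residues-sum
  where
  open ≡-Reasoning
  m n N c : ℕ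
  m = 2 + a * 4
  n = 1 + b * 2
  N = m * n
  -- Chosen so that (1 + 2a)(1 + 2b) = 1 + 2c, which shows `N` to be twice an odd number.
  c = a + b + 2 * (a * b)

  open SimpleGraph (K m ∘ₗ K̅ n) using (vertexAt; enum)
  open DirectedDistanceMagicLabeling (proj₂ odm) using (l; labeling)

  N≡2[1+2c] : + N ≡ + 2 ℤ.* (1ℤ ℤ.+ + 2 ℤ.* + c)
  N≡2[1+2c] = begin
    + N                               ≡⟨ cong +_ (eq a b) ⟩
    + (2 * (1 + 2 * c))               ≡⟨ ℤ.pos-* 2 (1 + 2 * c) ⟩
    + 2 ℤ.* (1ℤ ℤ.+ + (2 * c))        ≡⟨ cong (λ x → + 2 ℤ.* (1ℤ ℤ.+ x)) (ℤ.pos-* 2 c) ⟩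
    + 2 ℤ.* (1ℤ ℤ.+ + 2 ℤ.* + c)      ∎
    where
    eq : ∀ a b → (2 + a * 4) * (1 + b * 2) ≡ 2 * (1 + 2 * (a + b + 2 * (a * b)))
    eq = ℕ-Solver.solve-∀

  2∣N : + 2 ∣ + N
  2∣N = divides (1ℤ ℤ.+ + 2 ℤ.* + c) (trans N≡2[1+2c] (ℤ.*-comm (+ 2) _))

  open Parity {m} {n} 2∣N (s≤s z≤n) odm using (μ; partSum; total; total≡sum-partSum; partSum-parity)

  residues-sum : ℤ
  residues-sum = sum (λ (r : Fin N) → + toℕ r)

  -- N(N - 1)/2 is the product of the odd numbers 1 + 2c and 1 + 4c.
  residues-sum-odd : residues-sum ≡ + 2 ℤ.* ((+ 4 ℤ.* + c ℤ.+ + 3) ℤ.* + c) ℤ.+ 1ℤ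
  residues-sum-odd = ℤ.*-cancelˡ-≡ (+ 2) _ _ (begin
    + 2 ℤ.* residues-sum
      ≡⟨ sum-toℕ N ⟩
    + N ℤ.* (+ N ℤ.- 1ℤ)
      ≡⟨ cong (λ N → N ℤ.* (N ℤ.- 1ℤ)) N≡2[1+2c] ⟩
    + 2 ℤ.* (1ℤ ℤ.+ + 2 ℤ.* + c) ℤ.* (+ 2 ℤ.* (1ℤ ℤ.+ + 2 ℤ.* + c) ℤ.- 1ℤ)
      ≡⟨ eq (+ c) ⟩
    + 2 ℤ.* (+ 2 ℤ.* ((+ 4 ℤ.* + c ℤ.+ + 3) ℤ.* + c) ℤ.+ 1ℤ) ∎)
    where
    eq : ∀ c → + 2 ℤ.* (1ℤ ℤ.+ + 2 ℤ.* c) ℤ.* (+ 2 ℤ.* (1ℤ ℤ.+ + 2 ℤ.* c) ℤ.- 1ℤ)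
           ≡ + 2 ℤ.* (+ 2 ℤ.* ((+ 4 ℤ.* c ℤ.+ + 3) ℤ.* c) ℤ.+ 1ℤ)
    eq = ℤ-Solver.solve-∀

  l-onto : Onto N (λ k → l (vertexAt k))
  l-onto z = let v , to≡z = Bijection.surjective labeling z in
    Inverse.from enum v , subst (λ w → l w ≡ z mod N) (sym (Inverse.strictlyInverseˡ enum v)) (to≡z refl)

  total≡residues-sum : total ≡ residues-sum mod N
  total≡residues-sum =
    sum-reindex {l = λ k → l (vertexAt k)} l-onto (Mod.commutativeMonoid N) (λ z → z) (λ a≡b → a≡b)

  d : ℤ
  d = total ℤ.- μ

  ∑d≡m*d : sum (λ (_ : Fin m) → d) ≡ + m ℤ.* d
  ∑d≡m*d = begin
    sum (λ (_ : Fin m) → d)                ≡⟨ sum-cong-≗ {m} (λ _ → ℤ.*-identityˡ d) ⟨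
    sum (λ (_ : Fin m) → 1ℤ ℤ.* d)         ≡⟨ *-distribʳ-sum d (λ (_ : Fin m) → 1ℤ) ⟨
    sum (λ (_ : Fin m) → 1ℤ) ℤ.* d         ≡⟨ cong (ℤ._* d) (sum-ones m) ⟩
    + m ℤ.* d                              ∎

  2∣m : + 2 ∣ + m
  2∣m = divides (1ℤ ℤ.+ + 2 ℤ.* + a) (trans (cong (λ z → + 2 ℤ.+ z) (ℤ.pos-* a 4)) (eq (+ a)))
    where
    eq : ∀ a → + 2 ℤ.+ a ℤ.* + 4 ≡ (1ℤ ℤ.+ + 2 ℤ.* a) ℤ.* + 2
    eq = ℤ-Solver.solve-∀

  -- Every part sum has the parity of `d`, so `total` has that of `m * d`, and `m` is even.
  2∣total : + 2 ∣ total
  2∣total = ∣m+n∣n⇒∣m {+ 2} {total} {ℤ.- (+ m ℤ.* d)}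
    (subst (+ 2 ∣_) parts-sum (∣-sum (λ i →
      subst (+ 2 ∣_) (cong (λ z → partSum i ℤ.+ z) (sym (ℤ.-1*i≡-i d))) (partSum-parity i))))
    (∣m⇒∣-m (∣m⇒∣m*n d 2∣m))
    where
    parts-sum : sum (λ i → partSum i ℤ.+ -1ℤ ℤ.* d) ≡ total ℤ.- + m ℤ.* d
    parts-sum = trans (sum-minus partSum (λ _ → d)) (cong₂ ℤ._-_ (sym total≡sum-partSum) ∑d≡m*d)

  2∣residues-sum : + 2 ∣ residues-sum
  2∣residues-sum = subst (+ 2 ∣_) (eq total residues-sum) (∣m∣n⇒∣m-n 2∣total (∣-trans 2∣N total≡residues-sum))
    where
    eq : ∀ a b → a ℤ.- (a ℤ.- b) ≡ b
    eq = ℤ-Solver.solve-∀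

-- Case analysis on m and n.

-- Half of the order is `m * q`, a multiple of `m`; this is the `half∈part` condition for even `n`.
half-of-even : ∀ m q r → r + r ≡ m * (q * 2) → m ℕ.∣ r
half-of-even m q r r+r≡N = subst (m ℕ.∣_) (sym (ℕ.*-cancelˡ-≡ r (m * q) 2 (begin
  2 * r        ≡⟨ cong (λ z → r + z) (ℕ.+-identityʳ r) ⟩
  r + r        ≡⟨ r+r≡N ⟩
  m * (q * 2)  ≡⟨ eq m q ⟩
  2 * (m * q)  ∎))) (ℕ.m∣m*n q)
  where
  open ≡-Reasoning
  eq : ∀ m q → m * (q * 2) ≡ 2 * (m * q)
  eq = ℕ-Solver.solve-∀

-- An odd order has no half, so `half∈part` holds vacuously.
half-of-odd : ∀ a b r → ¬ (r + r ≡ (1 + a * 2) * (1 + b * 2))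
half-of-odd a b r r+r≡N = ℕ.even≢odd r (a + b + 2 * (a * b)) (begin
  2 * r                              ≡⟨ cong (λ z → r + z) (ℕ.+-identityʳ r) ⟩
  r + r                              ≡⟨ r+r≡N ⟩
  (1 + a * 2) * (1 + b * 2)          ≡⟨ eq a b ⟩
  ℕ.suc (2 * (a + b + 2 * (a * b)))  ∎)
  where
  open ≡-Reasoning
  eq : ∀ a b → (1 + a * 2) * (1 + b * 2) ≡ 1 + 2 * (a + b + 2 * (a * b))
  eq = ℕ-Solver.solve-∀

magic-even-n : ∀ {m} q .{{_ : NonZero (m * (q * 2))}} →
               OrientableDistanceMagic (ℤMod (m * (q * 2))) (K m ∘ₗ K̅ (q * 2))
magic-even-n {m} q = Circulant.magic m (q * 2) (half-of-even m q)

magic-odd-odd : ∀ {m} a b → m ≡ 1 + a * 2 →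
                OrientableDistanceMagic (ℤMod (m * (1 + b * 2))) (K m ∘ₗ K̅ (1 + b * 2))
magic-odd-odd a b refl = Circulant.magic (1 + a * 2) (1 + b * 2)
  λ r r+r≡N → contradiction r+r≡N (half-of-odd a b r)

-- The residues `ρ` of `m` modulo 4 and `ς` of `n` modulo 2 are variables tied to `m` and `n` by
-- equations, so that they can be matched against literals. Even `n` and odd `m` lead to circulants,
-- `ρ` = 0 with `ς` = 1 to signed zero-sum parts.
magic-n≥2 : ∀ {m n} ρ ς a b → m ≡ ρ + a * 4 → n ≡ ς + b * 2 → ρ < 4 → ς < 2 → 1 ≤ m → 2 ≤ n →
            ς ≢ 1 ⊎ ρ ≢ 2 → OrientableDistanceMagic (ℤMod (m * n)) (K m ∘ₗ K̅ n)
magic-n≥2 {m} ρ 0 a b _ refl _ _ 1≤m 2≤n _ =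
  magic-even-n b {{ℕ.m*n≢0 m (b * 2) {{ℕ.>-nonZero 1≤m}} {{ℕ.>-nonZero (ℕ.<⇒≤ 2≤n)}}}}
-- Here `n` would be 1, against `2 ≤ n`; otherwise `n` is `3 + r * 2`.
magic-n≥2 0 1 a ℕ.zero refl refl _ _ _ (s≤s ()) _
magic-n≥2 0 1 a (ℕ.suc r) refl refl _ _ 1≤m 2≤n _ =
  subst (λ m → OrientableDistanceMagic (ℤMod (m * (3 + r * 2))) (K m ∘ₗ K̅ (3 + r * 2))) (eq a)
    (FourDivides.magic a r
      {{ℕ.m*n≢0 ((a + a) * 2) (3 + r * 2) {{ℕ.>-nonZero (subst (1 ≤_) (sym (eq a)) 1≤m)}}}})
  where
  eq : ∀ a → (a + a) * 2 ≡ a * 4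
  eq = ℕ-Solver.solve-∀
magic-n≥2 1 1 a b refl refl _ _ _ _ _ = magic-odd-odd (a * 2) b (eq a)
  where
  eq : ∀ a → 1 + a * 4 ≡ 1 + a * 2 * 2
  eq = ℕ-Solver.solve-∀
magic-n≥2 2 1 _ _ _ _ _ _ _ _ (inj₁ 1≢1) = contradiction refl 1≢1
magic-n≥2 2 1 _ _ _ _ _ _ _ _ (inj₂ 2≢2) = contradiction refl 2≢2
magic-n≥2 3 1 a b refl refl _ _ _ _ _ = magic-odd-odd (1 + a * 2) b (eq a)
  where
  eq : ∀ a → 3 + a * 4 ≡ 1 + (1 + a * 2) * 2
  eq = ℕ-Solver.solve-∀
magic-n≥2 (ℕ.suc (ℕ.suc (ℕ.suc (ℕ.suc _)))) 1 _ _ _ _ (s≤s (s≤s (s≤s (s≤s ())))) _ _ _ _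
magic-n≥2 _ (ℕ.suc (ℕ.suc _)) _ _ _ _ _ (s≤s (s≤s ())) _ _ _

theorem5 : (m n : ℕ) → 1 ≤ m → 1 ≤ n →
    (2 ≤ n →
    OrientableDistanceMagic (ℤMod (m * n)) (K m ∘ₗ K̅ n) ⇔ (n % 2 ≢ 1 % 2 ⊎ m % 4 ≢ 2 % 4))
    × (n ≡ 1 →
    OrientableDistanceMagic (ℤMod m) (K m ∘ₗ K̅ n) ⇔ (m % 2 ≡ 1))
theorem5 m n 1≤m 1≤n = (λ 2≤n → mk⇔ necessary (sufficient 2≤n)) , λ { refl → mk⇔ necessary₁ sufficient₁ }
  where
  necessary : OrientableDistanceMagic (ℤMod (m * n)) (K m ∘ₗ K̅ n) → n % 2 ≢ 1 ⊎ m % 4 ≢ 2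
  necessary odm with n % 2 ℕ.≟ 1 | m % 4 ℕ.≟ 2
  ... | no n%2≢1 | _ = inj₁ n%2≢1
  ... | yes _ | no m%4≢2 = inj₂ m%4≢2
  ... | yes n%2≡1 | yes m%4≡2 = contradiction
    (subst₂ (λ m n → OrientableDistanceMagic (ℤMod (m * n)) (K m ∘ₗ K̅ n))
      (trans (m≡m%n+[m/n]*n m 4) (cong (_+ m / 4 * 4) m%4≡2))
      (trans (m≡m%n+[m/n]*n n 2) (cong (_+ n / 2 * 2) n%2≡1)) odm)
    (¬magic-2mod4 {m / 4} {n / 2})

  sufficient : 2 ≤ n → n % 2 ≢ 1 ⊎ m % 4 ≢ 2 → OrientableDistanceMagic (ℤMod (m * n)) (K m ∘ₗ K̅ n)
  sufficient = magic-n≥2 (m % 4) (n % 2) (m / 4) (n / 2) (m≡m%n+[m/n]*n m 4) (m≡m%n+[m/n]*n n 2)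
    (m%n<n m 4) (m%n<n n 2) 1≤m

  necessary₁ : OrientableDistanceMagic (ℤMod m) (K m ∘ₗ K̅ 1) → m % 2 ≡ 1
  necessary₁ odm with m % 2 in m%2 | m%n<n m 2
  ... | 1 | _ = refl
  ... | 0 | _ = contradiction
    (subst (λ m → OrientableDistanceMagic (ℤMod m) (K m ∘ₗ K̅ 1))
      (trans (m≡m%n+[m/n]*n m 2) (cong (_+ m / 2 * 2) m%2)) odm)
    (¬magic-n≡1 {m / 2})
  ... | ℕ.suc (ℕ.suc _) | s≤s (s≤s ())

  sufficient₁ : m % 2 ≡ 1 → OrientableDistanceMagic (ℤMod m) (K m ∘ₗ K̅ 1)
  -- The odd circulant with `b` = 0 comes with modulus `m * 1`.
  sufficient₁ m%2≡1 = subst (λ N → OrientableDistanceMagic (ℤMod N) (K m ∘ₗ K̅ 1)) (ℕ.*-identityʳ m)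
    (magic-odd-odd (m / 2) 0 (trans (m≡m%n+[m/n]*n m 2) (cong (_+ m / 2 * 2) m%2≡1)))
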